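{- Let $G$ be a connected graph on $n\ge 12$ vertices with $\gamma(G)\neq 2$. Then the parameters $dav(G,k_1,k_2,k_3)$ for all nonnegative integers $k_1,k_2,k_3$ with $0\le k_1+k_2+k_3\le n-3$, and $dav(G,k_1,k,k)$ for all nonnegative integers $k_1,k$ with $0\le k_1+2k\le n-3$, are reconstructible; that is, for every graph $H$ with $\mathscr{D}(H)=\mathscr{D}(G)$ these parameters take the same values on $H$ as on $G$.
   Context: All graphs are finite, simple and undirected; $\gamma(G)$ is the domination number. For a vertex $v$, the card $G-v$ is the unlabeled graph obtained by deleting $v$; the deck $\mathscr{D}(G)$ is the multiset of all cards. For nonnegative integers $k_1,k_2,k_3$, $dav(G,k_1,k_2,k_3)$ denotes the number of pairs of adjacent vertices $x$ and $y$ in $G$ such that exactly $k_1$ vertices are adjacent to both $x$ and $y$, exactly $k_2$ vertices other than $y$ are adjacent to $x$ but not to $y$, and exactly $k_3$ vertices other than $x$ are adjacent to $y$ but not to $x$. -}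

module Defs where

open import Data.Bool using (Bool; false; T; T?)
open import Data.Fin using (Fin; punchIn)
open import Data.Fin.Properties using (_≟_; _<?_)
open import Data.Fin.Subset using (Subset; _∈_; ∣_∣)
open import Data.List using (List; length; filter; tabulate; allFin; cartesianProduct)
open import Data.Nat as ℕ using (ℕ; suc; _≤_)
open import Data.Product using (_×_; _,_; ∃-syntax)
open import Data.Sum using (_⊎_)
open import Function using (_↔_; Inverse)
open import Function.Construct.Composition using (_↔-∘_)
open import Function.Construct.Identity using (↔-id)
open import Function.Construct.Symmetry using (↔-sym)
open import Level using (0ℓ)
open import Relation.Binary using (Rel; Setoid; Decidable)
open import Relation.Binary.Construct.Closure.ReflexiveTransitive using (Star)
open import Relation.Binary.PropositionalEquality
open import Relation.Nullary using (¬?; _×-dec_; _⊎-dec_)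
import Relation.Unary as U
import Data.List.Relation.Binary.Permutation.Setoid as Permutation

record Graph : Set where
  constructor mkGraph
  field
    order      : ℕ
    adj        : Fin order → Fin order → Bool
    adj-sym    : ∀ x y → adj x y ≡ adj y x
    adj-irrefl : ∀ x → adj x x ≡ false

  Vertex : Set
  Vertex = Fin order

  Adj : Rel Vertex 0ℓ
  Adj x y = T (adj x y)

  adj? : Decidable Adj
  adj? x y = T? (adj x y)

open Graph public

record _≅_ (G H : Graph) : Set where
  constructor mk≅
  field
    bijection : Vertex G ↔ Vertex H
    preserves : ∀ x y → adj G x y ≡ adj H (Inverse.to bijection x) (Inverse.to bijection y)

≅-refl : ∀ {G} → G ≅ G
≅-refl = mk≅ (↔-id _) (λ _ _ → refl)

≅-sym : ∀ {G H} → G ≅ H → H ≅ G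
≅-sym {G} {H} (mk≅ f p) = mk≅ (↔-sym f) λ x y →
  sym (trans (p (from x) (from y)) (cong₂ (adj H) (strictlyInverseˡ x) (strictlyInverseˡ y)))
  where open Inverse f

≅-trans : ∀ {G H K} → G ≅ H → H ≅ K → G ≅ K
≅-trans (mk≅ f p) (mk≅ g q) = mk≅ (g ↔-∘ f) λ x y →
  trans (p x y) (q (Inverse.to f x) (Inverse.to f y))

-- Unlabeled graphs are graphs taken up to the equality of this setoid.
≅-setoid : Setoid 0ℓ 0ℓ
≅-setoid = record
  { Carrier       = Graph
  ; _≈_           = _≅_
  ; isEquivalence = record { refl = ≅-refl ; sym = ≅-sym ; trans = ≅-trans }
  }

infixl 6 _-_

-- G - v: punchIn v enumerates the vertices other than v.
_-_ : (G : Graph) → Vertex G → Graph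
mkGraph (suc n) a s i - v = mkGraph n
  (λ x y → a (punchIn v x) (punchIn v y))
  (λ x y → s (punchIn v x) (punchIn v y))
  (λ x → i (punchIn v x))

deck : (G : Graph) → List Graph
deck G = tabulate (λ v → G - v)

-- Equality of decks as multisets of unlabeled graphs.
infix 4 _≈ᴰ_

_≈ᴰ_ : Rel (List Graph) 0ℓ
_≈ᴰ_ = Permutation._↭_ ≅-setoid

ReconstructibleAt : Graph → (Graph → ℕ) → Set
ReconstructibleAt G p = ∀ H → deck H ≈ᴰ deck G → p H ≡ p G

-- The graph of order 0 counts as connected.
Connected : Graph → Set
Connected G = ∀ x y → Star (Adj G) x y

Dominating : (G : Graph) → Subset (order G) → Set
Dominating G S = ∀ v → v ∈ S ⊎ (∃[ u ] (u ∈ S × Adj G u v))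

-- γ(G) = k
IsDominationNumber : Graph → ℕ → Set
IsDominationNumber G k =
  (∃[ S ] (Dominating G S × ∣ S ∣ ≡ k)) × (∀ S → Dominating G S → k ≤ ∣ S ∣)

count : ∀ {n} {P : Fin n → Set} → U.Decidable P → ℕ
count P? = length (filter P? (allFin _))

commonNbrs : (G : Graph) → Vertex G → Vertex G → ℕ
commonNbrs G x y = count (λ z → adj? G z x ×-dec adj? G z y)

-- The number of vertices other than y adjacent to x but not to y.
privateNbrs : (G : Graph) → Vertex G → Vertex G → ℕ
privateNbrs G x y = count (λ z → ¬? (z ≟ y) ×-dec adj? G z x ×-dec ¬? (adj? G z y))

DavPair : (G : Graph) (k₁ k₂ k₃ : ℕ) → Rel (Vertex G) 0ℓ
DavPair G k₁ k₂ k₃ x y =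
  Adj G x y × commonNbrs G x y ≡ k₁ × privateNbrs G x y ≡ k₂ × privateNbrs G y x ≡ k₃

davPair? : ∀ G k₁ k₂ k₃ → Decidable (DavPair G k₁ k₂ k₃)
davPair? G k₁ k₂ k₃ x y =
  adj? G x y ×-dec commonNbrs G x y ℕ.≟ k₁ ×-dec
  privateNbrs G x y ℕ.≟ k₂ ×-dec privateNbrs G y x ℕ.≟ k₃

-- Pairs are unordered: each edge is represented by its endpoints (x , y) with
-- x < y, and is counted once if either naming of its ends satisfies the
-- condition.
dav : Graph → ℕ → ℕ → ℕ → ℕ
dav G k₁ k₂ k₃ = length (filter
  (λ (x , y) → x <? y ×-dec (davPair? G k₁ k₂ k₃ x y ⊎-dec davPair? G k₁ k₂ k₃ y x))
  (cartesianProduct (allFin (order G)) (allFin (order G))))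

{-# OPTIONS --safe #-}
-- Let n be the order of G. An edge xy with c common neighbours and p, q private
-- neighbours of x and y lies on level c + p + q, and it survives in the card G - v
-- for each v other than x and y, with one of c, p, q lowered by 1, or none if v is
-- adjacent to neither end. Hence, for every weight φ on triples, the sum of
-- φ (c, p, q) over the edges of all cards is the sum over the edges of G of
--   c φ (c - 1, p, q) + p φ (c, p - 1, q) + q φ (c, p, q - 1) + (n - 2 - c - p - q) φ (c, p, q),
-- and this last sum is reconstructible. For φ supported on a level s < n - 2 the
-- last coefficient is positive, so agreement of G and H on level s + 1 gives
-- agreement on level s, and it is enough to know that G and H agree on level n - 2,
-- the level of the dominating edges.
--
-- If G has a vertex w of degree n - 1, then counting edges shows that the vertex v
-- of H with H - v ≅ G - w also has degree n - 1, so H ≅ G. Otherwise γ(G) ≠ 2 says that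
-- level n - 2 is empty in G. If it were nonempty in H, then H would be connected,
-- so level 0 (the isolated edges) would be empty in both graphs; taking φ to be the
-- indicators of the levels and going up, all levels would have the same size in G
-- and H, in particular level n - 2, a contradiction.
module Submission where

open import Data.Bool using (Bool; true; false; T; not; _∧_; _∨_)
open import Data.Bool.Properties using (∧-zeroʳ; ∨-comm; ∧-comm; T-≡)
open import Data.Fin using (Fin; zero; suc; punchIn; punchOut)
open import Data.Fin.Permutation using (Permutation; insert; insert-punchIn; _⟨$⟩ʳ_)
open import Data.Fin.Properties using (_≟_; _<?_; <-cmp; any?; all?; punchInᵢ≢i; punchIn-injective; punchIn-punchOut)
open import Data.Fin.Subset using (Subset; inside; outside; ⁅_⁆; _∪_; ∣_∣; _∈_)
open import Data.Fin.Subset.Properties using (x∈⁅x⁆; ∣⁅x⁆∣≡1; x∈p∪q⁺; x∈p⇒∣p-x∣<∣p∣; x∈p∧x≢y⇒x∈p-y)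
open import Data.List using (List; []; _∷_; length; filter; tabulate; map; foldr; cartesianProduct; _++_)
import Data.List.Membership.Setoid.Properties as Membership
open import Data.List.Properties using (length-tabulate; length-++; filter-++; map-tabulate)
import Data.List.Relation.Binary.Permutation.Setoid as Permutation
import Data.List.Relation.Binary.Permutation.Setoid.Properties as PermutationProperties
open import Data.List.Relation.Binary.Pointwise using (Pointwise; []; _∷_)
open import Data.Nat using (ℕ; zero; suc; _+_; _*_; _∸_; _≤_; z≤n; s≤s; >-nonZero)
open import Data.Nat.Properties renaming (_≟_ to _≟ℕ_) hiding (_<?_; <-cmp)
open import Algebra.Properties.Semiring.Sum +-*-semiring
  using (sum; sum-cong-≗; sum-remove; sum-permute; sum-replicate-zero; ∑-distrib-+; ∑-comm; *-distribˡ-sum; *-distribʳ-sum)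
open import Data.Nat.Tactic.RingSolver using (solve-∀)
open import Data.Product using (_×_; _,_; ∃; ∃-syntax)
open import Data.Sum using (_⊎_; inj₁; inj₂)
open import Data.Vec using ([]; _∷_)
open import Function using (_∘_; mk⇔; Inverse; Injection; Equivalence)
open import Function.Properties.Inverse using (↔⇒↣)
open import Relation.Binary.Construct.Closure.ReflexiveTransitive using (Star; ε; _◅_; _◅◅_)
open import Relation.Binary.Definitions using (tri<; tri≈; tri>)
open import Relation.Binary.PropositionalEquality
open import Relation.Nullary using (¬_; Dec; ¬?; _×-dec_; _⊎-dec_; does; yes; no; contradiction)
open import Relation.Nullary.Decidable using (dec-true; dec-false; does-⇔)
import Relation.Unary as U
open import Defs

-- Indicators and finite sums

𝟙 : Bool → ℕ
𝟙 true  = 1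
𝟙 false = 0

𝟙*-cong : ∀ b {m n} → (T b → m ≡ n) → 𝟙 b * m ≡ 𝟙 b * n
𝟙*-cong true  h = cong (1 *_) (h _)
𝟙*-cong false h = refl

*𝟙-cong : ∀ {A : Set} (A? : Dec A) {m n} → (A → m ≡ n) → m * 𝟙 (does A?) ≡ n * 𝟙 (does A?)
*𝟙-cong (yes a) h = cong (_* 1) (h a)
*𝟙-cong (no _) {m} {n} h = trans (*-zeroʳ m) (sym (*-zeroʳ n))

m+m-injective : ∀ {m n} → m + m ≡ n + n → m ≡ n
m+m-injective {m} {n} eq = *-cancelˡ-≡ m n 2 (trans (double m) (trans eq (sym (double n))))
  where
  double : ∀ k → 2 * k ≡ k + k
  double = solve-∀

sum-zero : ∀ {n} {t : Fin n → ℕ} → (∀ i → t i ≡ 0) → sum t ≡ 0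
sum-zero {n} h = trans (sum-cong-≗ h) (sum-replicate-zero n)

sum≡0⇒≡0 : ∀ {n} (t : Fin n → ℕ) → sum t ≡ 0 → ∀ i → t i ≡ 0
sum≡0⇒≡0 t h zero    = m+n≡0⇒m≡0 (t zero) h
sum≡0⇒≡0 t h (suc i) = sum≡0⇒≡0 (t ∘ suc) (m+n≡0⇒n≡0 (t zero) h) i

sum-one : ∀ n → sum {n} (λ _ → 1) ≡ n
sum-one zero    = refl
sum-one (suc n) = cong suc (sum-one n)

sum-punchIn : ∀ {n} v (t : Fin (suc n) → ℕ) → t v ≡ 0 → sum (t ∘ punchIn v) ≡ sum t
sum-punchIn v t tv≡0 = sym (trans (sum-remove t) (cong (_+ sum (t ∘ punchIn v)) tv≡0))

sum-𝟙≟ : ∀ {n} (x : Fin n) → sum (λ z → 𝟙 (does (z ≟ x))) ≡ 1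
sum-𝟙≟ {suc n} x = trans (sum-remove {i = x} (λ z → 𝟙 (does (z ≟ x)))) (cong₂ _+_
  (cong 𝟙 (dec-true (x ≟ x) refl))
  (sum-zero λ z → cong 𝟙 (dec-false (punchIn x z ≟ x) (punchInᵢ≢i x z))))

length-filter-tabulate : ∀ {n} {A : Set} {P : A → Set} (P? : U.Decidable P) (f : Fin n → A) →
  length (filter P? (tabulate f)) ≡ sum (λ i → 𝟙 (does (P? (f i))))
length-filter-tabulate {zero}  P? f = refl
length-filter-tabulate {suc n} P? f with does (P? (f zero))
... | true  = cong suc (length-filter-tabulate P? (f ∘ suc))
... | false = length-filter-tabulate P? (f ∘ suc)

count≡sum : ∀ {n} {P : Fin n → Set} (P? : U.Decidable P) → count P? ≡ sum (λ i → 𝟙 (does (P? i)))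
count≡sum P? = length-filter-tabulate P? (λ i → i)

-- Vertices classified by an edge

-- `isPrivate` has to exclude `y` explicitly, since `y` may be adjacent to `x` and is never adjacent
-- to itself; irreflexivity already keeps `x` out, and both ends out of `isCommon`.
isCommon isPrivate isOutside : (G : Graph) (x y z : Vertex G) → Bool
isCommon  G x y z = adj G z x ∧ adj G z y
isPrivate G x y z = not (does (z ≟ y)) ∧ adj G z x ∧ not (adj G z y)
isOutside G x y z = not (does (z ≟ x)) ∧ not (does (z ≟ y)) ∧ not (adj G z x) ∧ not (adj G z y)

commonNbrs≡sum : ∀ G x y → commonNbrs G x y ≡ sum (𝟙 ∘ isCommon G x y)
commonNbrs≡sum G x y = count≡sum (λ z → adj? G z x ×-dec adj? G z y)

privateNbrs≡sum : ∀ G x y → privateNbrs G x y ≡ sum (𝟙 ∘ isPrivate G x y)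
privateNbrs≡sum G x y = count≡sum (λ z → ¬? (z ≟ y) ×-dec adj? G z x ×-dec ¬? (adj? G z y))

commonNbrs-sym : ∀ G x y → commonNbrs G x y ≡ commonNbrs G y x
commonNbrs-sym G x y = begin
  commonNbrs G x y          ≡⟨ commonNbrs≡sum G x y ⟩
  sum (𝟙 ∘ isCommon G x y)  ≡⟨ sum-cong-≗ (λ z → cong 𝟙 (∧-comm (adj G z x) (adj G z y))) ⟩
  sum (𝟙 ∘ isCommon G y x)  ≡⟨ commonNbrs≡sum G y x ⟨
  commonNbrs G y x          ∎
  where open ≡-Reasoning

Adj⇒≢ : ∀ G {x y} → Adj G x y → x ≢ y
Adj⇒≢ G {x} xy refl = subst T (adj-irrefl G x) xy

-- For an edge this is its level.
span : (G : Graph) → Vertex G → Vertex G → ℕ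
span G x y = commonNbrs G x y + privateNbrs G x y + privateNbrs G y x

outsiders : (G : Graph) → Vertex G → Vertex G → ℕ
outsiders G x y = sum (𝟙 ∘ isOutside G x y)

module _ (G : Graph) {x y : Vertex G} (xy : Adj G x y) where

  vertex-partition : ∀ z → 𝟙 (does (z ≟ x)) + 𝟙 (does (z ≟ y)) +
    (𝟙 (isCommon G x y z) + 𝟙 (isPrivate G x y z) + 𝟙 (isPrivate G y x z) + 𝟙 (isOutside G x y z)) ≡ 1
  vertex-partition z with z ≟ x | z ≟ y
  ... | yes refl | yes refl = contradiction refl (Adj⇒≢ G xy)
  ... | yes refl | no _ rewrite adj-irrefl G x = refl
  ... | no _ | yes refl rewrite adj-irrefl G y | ∧-zeroʳ (adj G y x) = refl
  ... | no _ | no _ with adj G z x | adj G z y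
  ... | true | true = refl
  ... | true | false = refl
  ... | false | true = refl
  ... | false | false = refl

  -- `vertex-partition` is summed over all vertices; the 2 accounts for the ends `x` and `y`.
  order≡2+span+outsiders : 2 + (span G x y + outsiders G x y) ≡ order G
  order≡2+span+outsiders = begin
    2 + (span G x y + outsiders G x y)
      ≡⟨ cong₂ (λ c p → 2 + (c + p + privateNbrs G y x + outsiders G x y)) (commonNbrs≡sum G x y) (privateNbrs≡sum G x y) ⟩
    2 + (sum c + sum p + privateNbrs G y x + sum o)
      ≡⟨ cong₂ (λ s q → s + (sum c + sum p + q + sum o)) (cong₂ _+_ (sym (sum-𝟙≟ x)) (sym (sum-𝟙≟ y))) (privateNbrs≡sum G y x) ⟩
    sum ex + sum ey + (sum c + sum p + sum q + sum o)
      ≡⟨ cong₂ _+_ (∑-distrib-+ ex ey)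
           (trans (∑-distrib-+ (λ z → c z + p z + q z) o) (cong (_+ sum o)
             (trans (∑-distrib-+ (λ z → c z + p z) q) (cong (_+ sum q) (∑-distrib-+ c p))))) ⟨
    sum (λ z → ex z + ey z) + sum (λ z → c z + p z + q z + o z)
      ≡⟨ ∑-distrib-+ (λ z → ex z + ey z) (λ z → c z + p z + q z + o z) ⟨
    sum (λ z → ex z + ey z + (c z + p z + q z + o z))
      ≡⟨ trans (sum-cong-≗ vertex-partition) (sum-one _) ⟩
    order G ∎
    where
    open ≡-Reasoning
    ex ey c p q o : Vertex G → ℕ
    ex z = 𝟙 (does (z ≟ x))
    ey z = 𝟙 (does (z ≟ y))
    c z = 𝟙 (isCommon G x y z)
    p z = 𝟙 (isPrivate G x y z)
    q z = 𝟙 (isPrivate G y x z)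
    o z = 𝟙 (isOutside G x y z)

  outsiders≡ : outsiders G x y ≡ order G ∸ (2 + span G x y)
  outsiders≡ = sym (trans (cong (_∸ (2 + span G x y)) (sym order≡2+span+outsiders)) (m+n∸m≡n (2 + span G x y) _))

-- Weighted edge sums and deletion of a vertex

Weight : Set
Weight = (c p q : ℕ) → ℕ

weightAt : (G : Graph) → Weight → Vertex G → Vertex G → ℕ
weightAt G φ x y = φ (commonNbrs G x y) (privateNbrs G x y) (privateNbrs G y x)

-- The sum runs over ordered pairs: every edge enters twice, once with `p` and `q` exchanged. This
-- avoids an order on the vertices, which isomorphisms would not respect.
edgeSum : Graph → Weight → ℕ
edgeSum G φ = sum λ x → sum λ y → 𝟙 (adj G x y) * weightAt G φ x y

edgeSum-cong : ∀ G φ ψ → (∀ x y → Adj G x y → weightAt G φ x y ≡ weightAt G ψ x y) →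
  edgeSum G φ ≡ edgeSum G ψ
edgeSum-cong G φ ψ h = sum-cong-≗ λ x → sum-cong-≗ λ y → 𝟙*-cong (adj G x y) (h x y)

edgeSum-cong-≗ : ∀ G φ ψ → (∀ c p q → φ c p q ≡ ψ c p q) → edgeSum G φ ≡ edgeSum G ψ
edgeSum-cong-≗ G φ ψ h = edgeSum-cong G φ ψ λ x y _ → h (commonNbrs G x y) (privateNbrs G x y) (privateNbrs G y x)

edgeSum-zero : ∀ G φ → (∀ x y → Adj G x y → weightAt G φ x y ≡ 0) → edgeSum G φ ≡ 0
edgeSum-zero G φ h = sum-zero λ x → sum-zero λ y →
  trans (𝟙*-cong (adj G x y) (h x y)) (*-zeroʳ (𝟙 (adj G x y)))

edgeSum-+ : ∀ G φ ψ → edgeSum G (λ c p q → φ c p q + ψ c p q) ≡ edgeSum G φ + edgeSum G ψ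
edgeSum-+ G φ ψ = trans
  (sum-cong-≗ λ x → trans
    (sum-cong-≗ λ y → *-distribˡ-+ (𝟙 (adj G x y)) (weightAt G φ x y) (weightAt G ψ x y))
    (∑-distrib-+ _ (λ y → 𝟙 (adj G x y) * weightAt G ψ x y)))
  (∑-distrib-+ _ (λ x → sum λ y → 𝟙 (adj G x y) * weightAt G ψ x y))

edgeSum-* : ∀ G m φ → edgeSum G (λ c p q → m * φ c p q) ≡ m * edgeSum G φ
edgeSum-* G m φ = sym (trans (*-distribˡ-sum m (λ x → sum λ y → 𝟙 (adj G x y) * weightAt G φ x y))
  (sum-cong-≗ λ x → trans (*-distribˡ-sum m (λ y → 𝟙 (adj G x y) * weightAt G φ x y))
    (sum-cong-≗ λ y → swap m (𝟙 (adj G x y)) (weightAt G φ x y))))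
  where
  swap : ∀ a b c → a * (b * c) ≡ b * (a * c)
  swap = solve-∀

-- The vertex z contributes φ evaluated at the parameters of the edge xy in the
-- card G - z; there is no contribution when z is an end of the edge.
lossAt : (G : Graph) → Weight → (x y z : Vertex G) → ℕ
lossAt G φ x y z =
  𝟙 (isCommon G x y z) * φ (c ∸ 1) p q + 𝟙 (isPrivate G x y z) * φ c (p ∸ 1) q +
  𝟙 (isPrivate G y x z) * φ c p (q ∸ 1) + 𝟙 (isOutside G x y z) * φ c p q
  where
  c = commonNbrs G x y
  p = privateNbrs G x y
  q = privateNbrs G y x

-- The contribution of the deleted vertices that lower a parameter. Truncated subtraction is
-- harmless: where it would matter, the factor in front is 0.
shift : Weight → Weight
shift φ c p q = c * φ (c ∸ 1) p q + p * φ c (p ∸ 1) q + q * φ c p (q ∸ 1)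

-- The total weight of an edge over all cards that contain it, when the graph has order `n`. The
-- last coefficient is the number of vertices adjacent to neither end.
lift : ℕ → Weight → Weight
lift n φ c p q = shift φ c p q + (n ∸ (2 + (c + p + q))) * φ c p q

-- Vanishing at both ends allows a sum over the vertices of a card to be extended to all vertices of
-- `G`.
lossAt-end₁ : ∀ G φ x y → lossAt G φ x y x ≡ 0
lossAt-end₁ G φ x y rewrite adj-irrefl G x | ∧-zeroʳ (not (does (x ≟ y))) | dec-true (x ≟ x) refl = refl

lossAt-end₂ : ∀ G φ x y → lossAt G φ x y y ≡ 0
lossAt-end₂ G φ x y rewrite adj-irrefl G y | ∧-zeroʳ (adj G y x) | dec-true (y ≟ y) refl
  | ∧-zeroʳ (not (does (y ≟ x))) = refl

-- The values of `φ` do not depend on `z`, so each class of vertices contributes its size times one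
-- value. Adjacency enters through the size of the outside class.
sum-lossAt : ∀ G φ x y → Adj G x y → sum (lossAt G φ x y) ≡ weightAt G (lift (order G) φ) x y
sum-lossAt G φ x y xy = begin
  sum (λ z → C z * A + P z * B + Q z * D + O z * E)
    ≡⟨ ∑-distrib-+ (λ z → C z * A + P z * B + Q z * D) (λ z → O z * E) ⟩
  sum (λ z → C z * A + P z * B + Q z * D) + sum (λ z → O z * E)
    ≡⟨ cong₂ _+_ (trans (∑-distrib-+ (λ z → C z * A + P z * B) (λ z → Q z * D))
        (cong₂ _+_ (trans (∑-distrib-+ (λ z → C z * A) (λ z → P z * B))
          (cong₂ _+_ (pull C A (commonNbrs≡sum G x y)) (pull P B (privateNbrs≡sum G x y))))
          (pull Q D (privateNbrs≡sum G y x))))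
        (pull O E (sym (outsiders≡ G xy))) ⟩
  weightAt G (lift (order G) φ) x y ∎
  where
  open ≡-Reasoning
  c = commonNbrs G x y
  p = privateNbrs G x y
  q = privateNbrs G y x
  A = φ (c ∸ 1) p q
  B = φ c (p ∸ 1) q
  D = φ c p (q ∸ 1)
  E = φ c p q
  C P Q O : Vertex G → ℕ
  C = 𝟙 ∘ isCommon G x y
  P = 𝟙 ∘ isPrivate G x y
  Q = 𝟙 ∘ isPrivate G y x
  O = 𝟙 ∘ isOutside G x y
  pull : ∀ (t : Vertex G → ℕ) m {k} → k ≡ sum t → sum (λ z → t z * m) ≡ k * m
  pull t m refl = sym (*-distribʳ-sum m t)

does-≟-injective : ∀ {m n} (f : Fin m → Fin n) → (∀ {x y} → f x ≡ f y → x ≡ y) →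
  ∀ x y → does (f x ≟ f y) ≡ does (x ≟ y)
does-≟-injective f inj x y = does-⇔ (mk⇔ inj (cong f)) (f x ≟ f y) (x ≟ y)

does-≟-punchIn : ∀ {n} (v : Fin (suc n)) x y → does (punchIn v x ≟ punchIn v y) ≡ does (x ≟ y)
does-≟-punchIn v = does-≟-injective (punchIn v) (punchIn-injective v _ _)

-- Here `a` and `b` tell whether the deleted vertex is adjacent to `x` and to `y`, and `c`, `p`, `q`
-- are the parameters in the card. Exactly one of the four indicators is 1, and in its term the
-- subtraction undoes the addition.
loss-cases : ∀ (φ : Weight) a b c p q → φ c p q ≡
  𝟙 (a ∧ b) * φ (𝟙 (a ∧ b) + c ∸ 1) (𝟙 (a ∧ not b) + p) (𝟙 (b ∧ not a) + q) +
  𝟙 (a ∧ not b) * φ (𝟙 (a ∧ b) + c) (𝟙 (a ∧ not b) + p ∸ 1) (𝟙 (b ∧ not a) + q) +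
  𝟙 (b ∧ not a) * φ (𝟙 (a ∧ b) + c) (𝟙 (a ∧ not b) + p) (𝟙 (b ∧ not a) + q ∸ 1) +
  𝟙 (not a ∧ not b) * φ (𝟙 (a ∧ b) + c) (𝟙 (a ∧ not b) + p) (𝟙 (b ∧ not a) + q)
loss-cases φ true  true  c p q = lemma (φ c p q)
  where
  lemma : ∀ m → m ≡ m + 0 + 0 + 0 + 0
  lemma = solve-∀
loss-cases φ true  false c p q = lemma (φ c p q)
  where
  lemma : ∀ m → m ≡ m + 0 + 0 + 0
  lemma = solve-∀
loss-cases φ false true  c p q = lemma (φ c p q)
  where
  lemma : ∀ m → m ≡ m + 0 + 0
  lemma = solve-∀
loss-cases φ false false c p q = sym (+-identityʳ (φ c p q))

module _ {n : ℕ} (a : Fin (suc n) → Fin (suc n) → Bool)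
  (a-sym : ∀ x y → a x y ≡ a y x) (a-irrefl : ∀ x → a x x ≡ false) where

  private
    G = mkGraph (suc n) a a-sym a-irrefl

  module _ (v : Fin (suc n)) (x y : Fin n) where

    private
      X = punchIn v x
      Y = punchIn v y

    commonNbrs-remove : commonNbrs G X Y ≡ 𝟙 (a v X ∧ a v Y) + commonNbrs (G - v) x y
    commonNbrs-remove = trans (commonNbrs≡sum G X Y) (trans (sum-remove {i = v} (𝟙 ∘ isCommon G X Y))
      (cong (𝟙 (a v X ∧ a v Y) +_) (sym (commonNbrs≡sum (G - v) x y))))

    privateNbrs-remove : privateNbrs G X Y ≡ 𝟙 (a v X ∧ not (a v Y)) + privateNbrs (G - v) x y
    privateNbrs-remove = begin
      privateNbrs G X Y
        ≡⟨ privateNbrs≡sum G X Y ⟩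
      sum (𝟙 ∘ isPrivate G X Y)
        ≡⟨ sum-remove {i = v} (𝟙 ∘ isPrivate G X Y) ⟩
      𝟙 (isPrivate G X Y v) + sum (𝟙 ∘ isPrivate G X Y ∘ punchIn v)
        ≡⟨ cong₂ _+_
             (cong (λ b → 𝟙 (not b ∧ a v X ∧ not (a v Y))) (dec-false (v ≟ Y) (punchInᵢ≢i v y ∘ sym)))
             (sum-cong-≗ λ z → cong (λ b → 𝟙 (not b ∧ a (punchIn v z) X ∧ not (a (punchIn v z) Y))) (does-≟-punchIn v z y)) ⟩
      𝟙 (a v X ∧ not (a v Y)) + sum (𝟙 ∘ isPrivate (G - v) x y)
        ≡⟨ cong (𝟙 (a v X ∧ not (a v Y)) +_) (privateNbrs≡sum (G - v) x y) ⟨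
      𝟙 (a v X ∧ not (a v Y)) + privateNbrs (G - v) x y ∎
      where open ≡-Reasoning

  weightAt-remove : ∀ φ v x y → weightAt (G - v) φ x y ≡ lossAt G φ (punchIn v x) (punchIn v y) v
  weightAt-remove φ v x y
    rewrite commonNbrs-remove v x y | privateNbrs-remove v x y | privateNbrs-remove v y x
    | dec-false (v ≟ punchIn v x) (punchInᵢ≢i v x ∘ sym) | dec-false (v ≟ punchIn v y) (punchInᵢ≢i v y ∘ sym)
    = loss-cases φ (a v (punchIn v x)) (a v (punchIn v y)) _ _ _

-- Double counting of pairs of a deleted vertex and a surviving edge, by exchanging the order of
-- summation.
sum-edgeSum-cards : ∀ G φ → sum (λ v → edgeSum (G - v) φ) ≡ edgeSum G (lift (order G) φ)
sum-edgeSum-cards (mkGraph zero _ _ _) φ = refl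
sum-edgeSum-cards G@(mkGraph (suc n) a a-sym a-irrefl) φ = begin
  sum (λ v → edgeSum (G - v) φ)
    ≡⟨ sum-cong-≗ (λ v → sum-cong-≗ λ x → sum-cong-≗ λ y →
         cong (𝟙 (a (punchIn v x) (punchIn v y)) *_) (weightAt-remove a a-sym a-irrefl φ v x y)) ⟩
  sum (λ v → sum λ x → sum λ y → g v (punchIn v x) (punchIn v y))
    -- The pairs with an end at `v` are added back: their loss at `v` is 0.
    ≡⟨ sum-cong-≗ (λ v → trans
         (sum-cong-≗ λ x → sum-punchIn v (g v (punchIn v x)) (vanish (a (punchIn v x) v) (lossAt-end₂ G φ (punchIn v x) v)))
         (sum-punchIn v (λ x → sum (g v x)) (sum-zero λ y → vanish (a v y) (lossAt-end₁ G φ v y)))) ⟩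
  sum (λ v → sum λ x → sum λ y → g v x y)
    ≡⟨ ∑-comm (λ v x → sum λ y → g v x y) ⟩
  sum (λ x → sum λ v → sum λ y → g v x y)
    ≡⟨ sum-cong-≗ (λ x → ∑-comm (λ v y → g v x y)) ⟩
  sum (λ x → sum λ y → sum λ v → g v x y)
    ≡⟨ sum-cong-≗ (λ x → sum-cong-≗ λ y → trans (sym (*-distribˡ-sum (𝟙 (a x y)) (lossAt G φ x y)))
         (𝟙*-cong (a x y) (sum-lossAt G φ x y))) ⟩
  edgeSum G (lift (suc n) φ) ∎
  where
  open ≡-Reasoning
  g : (v x y : Fin (suc n)) → ℕ
  g v x y = 𝟙 (a x y) * lossAt G φ x y v
  vanish : ∀ b {m} → m ≡ 0 → 𝟙 b * m ≡ 0
  vanish b refl = *-zeroʳ (𝟙 b)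

-- Isomorphism and decks

module _ {G H : Graph} (G≅H : G ≅ H) where

  open _≅_ G≅H

  private
    f : Vertex G → Vertex H
    f = Inverse.to bijection

  commonNbrs-≅ : ∀ x y → commonNbrs G x y ≡ commonNbrs H (f x) (f y)
  commonNbrs-≅ x y = begin
    commonNbrs G x y                        ≡⟨ commonNbrs≡sum G x y ⟩
    sum (𝟙 ∘ isCommon G x y)                ≡⟨ sum-cong-≗ (λ z → cong 𝟙 (cong₂ _∧_ (preserves z x) (preserves z y))) ⟩
    sum (𝟙 ∘ isCommon H (f x) (f y) ∘ f)    ≡⟨ sum-permute (𝟙 ∘ isCommon H (f x) (f y)) bijection ⟨
    sum (𝟙 ∘ isCommon H (f x) (f y))        ≡⟨ commonNbrs≡sum H (f x) (f y) ⟨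
    commonNbrs H (f x) (f y)                ∎
    where open ≡-Reasoning

  privateNbrs-≅ : ∀ x y → privateNbrs G x y ≡ privateNbrs H (f x) (f y)
  privateNbrs-≅ x y = begin
    privateNbrs G x y                       ≡⟨ privateNbrs≡sum G x y ⟩
    sum (𝟙 ∘ isPrivate G x y)               ≡⟨ sum-cong-≗ (λ z → cong 𝟙 (cong₂ (λ e b → not e ∧ b)
                                                 (sym (does-≟-injective f (Injection.injective (↔⇒↣ bijection)) z y))
                                                 (cong₂ (λ b c → b ∧ not c) (preserves z x) (preserves z y)))) ⟩
    sum (𝟙 ∘ isPrivate H (f x) (f y) ∘ f)   ≡⟨ sum-permute (𝟙 ∘ isPrivate H (f x) (f y)) bijection ⟨
    sum (𝟙 ∘ isPrivate H (f x) (f y))       ≡⟨ privateNbrs≡sum H (f x) (f y) ⟨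
    privateNbrs H (f x) (f y)               ∎
    where open ≡-Reasoning

  weightAt-≅ : ∀ φ x y → weightAt G φ x y ≡ weightAt H φ (f x) (f y)
  weightAt-≅ φ x y rewrite commonNbrs-≅ x y | privateNbrs-≅ x y | privateNbrs-≅ y x = refl

  edgeSum-≅ : ∀ φ → edgeSum G φ ≡ edgeSum H φ
  edgeSum-≅ φ = begin
    edgeSum G φ
      ≡⟨ sum-cong-≗ (λ x → sum-cong-≗ λ y → cong₂ (λ b m → 𝟙 b * m) (preserves x y) (weightAt-≅ φ x y)) ⟩
    sum (λ x → sum λ y → g (f x) (f y))
      ≡⟨ sum-cong-≗ (λ x → sum-permute (g (f x)) bijection) ⟨
    sum (λ x → sum (g (f x)))
      ≡⟨ sum-permute (λ x → sum (g x)) bijection ⟨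
    edgeSum H φ ∎
    where
    open ≡-Reasoning
    g : Vertex H → Vertex H → ℕ
    g x y = 𝟙 (adj H x y) * weightAt H φ x y

listSum : (Graph → ℕ) → List Graph → ℕ
listSum f gs = foldr _+_ 0 (map f gs)

listSum-tabulate : ∀ {n} f (g : Fin n → Graph) → listSum f (tabulate g) ≡ sum (f ∘ g)
listSum-tabulate {zero}  f g = refl
listSum-tabulate {suc n} f g = cong (f (g zero) +_) (listSum-tabulate f (g ∘ suc))

listSum-≈ᴰ : ∀ {f} → (∀ {G H} → G ≅ H → f G ≡ f H) → ∀ {gs hs} → gs ≈ᴰ hs → listSum f gs ≡ listSum f hs
listSum-≈ᴰ inv (Permutation.refl gs≋hs)    = pointwise gs≋hs
  where
  pointwise : ∀ {gs hs} → Pointwise _≅_ gs hs → listSum _ gs ≡ listSum _ hs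
  pointwise []       = refl
  pointwise (p ∷ ps) = cong₂ _+_ (inv p) (pointwise ps)
listSum-≈ᴰ inv (Permutation.prep p ps)     = cong₂ _+_ (inv p) (listSum-≈ᴰ inv ps)
listSum-≈ᴰ {f} inv (Permutation.swap p q ps) =
  trans (cong₂ _+_ (inv p) (cong₂ _+_ (inv q) (listSum-≈ᴰ inv ps))) (swap (f _) (f _) _)
  where
  swap : ∀ a b c → a + (b + c) ≡ b + (a + c)
  swap = solve-∀
listSum-≈ᴰ inv (Permutation.trans ps qs)   = trans (listSum-≈ᴰ inv ps) (listSum-≈ᴰ inv qs)

module _ (G H : Graph) (H≈G : deck H ≈ᴰ deck G) where

  order-reconstructible : order H ≡ order G
  order-reconstructible = begin
    order H          ≡⟨ length-tabulate (λ v → H - v) ⟨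
    length (deck H)  ≡⟨ PermutationProperties.xs↭ys⇒|xs|≡|ys| ≅-setoid H≈G ⟩
    length (deck G)  ≡⟨ length-tabulate (λ v → G - v) ⟩
    order G          ∎
    where open ≡-Reasoning

  -- Both sides are the total of `edgeSum` over the cards, which is an isomorphism-invariant
  -- function of the deck.
  edgeSum-lift-reconstructible : ∀ φ → edgeSum H (lift (order G) φ) ≡ edgeSum G (lift (order G) φ)
  edgeSum-lift-reconstructible φ = begin
    edgeSum H (lift (order G) φ)         ≡⟨ cong (λ n → edgeSum H (lift n φ)) order-reconstructible ⟨
    edgeSum H (lift (order H) φ)         ≡⟨ sum-edgeSum-cards H φ ⟨
    sum (λ v → edgeSum (H - v) φ)        ≡⟨ listSum-tabulate (λ K → edgeSum K φ) (λ v → H - v) ⟨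
    listSum (λ K → edgeSum K φ) (deck H) ≡⟨ listSum-≈ᴰ (λ K≅L → edgeSum-≅ K≅L φ) H≈G ⟩
    listSum (λ K → edgeSum K φ) (deck G) ≡⟨ listSum-tabulate (λ K → edgeSum K φ) (λ v → G - v) ⟩
    sum (λ v → edgeSum (G - v) φ)        ≡⟨ sum-edgeSum-cards G φ ⟩
    edgeSum G (lift (order G) φ)         ∎
    where open ≡-Reasoning

  matching-card : ∀ w → ∃[ v ] ((G - w) ≅ (H - v))
  matching-card w = Membership.∈-tabulate⁻ ≅-setoid
    (PermutationProperties.∈-resp-↭ ≅-setoid (Permutation.↭-sym ≅-setoid H≈G)
      (Membership.∈-tabulate⁺ ≅-setoid w))

-- Levels

-- Lowering any positive parameter lowers the level by 1, so the three values of `h` coincide; a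
-- parameter equal to 0 contributes nothing.
shift-+ : ∀ (h : ℕ → ℕ) c p q → shift (λ c p q → h (c + p + q)) c p q ≡ (c + p + q) * h (c + p + q ∸ 1)
shift-+ h c p q = trans (cong₂ _+_ (cong₂ _+_ (first c) (second p)) (third q))
  (collect c p q (h (c + p + q ∸ 1)))
  where
  first : ∀ c → c * h (c ∸ 1 + p + q) ≡ c * h (c + p + q ∸ 1)
  first zero    = refl
  first (suc c) = refl
  second : ∀ p → p * h (c + (p ∸ 1) + q) ≡ p * h (c + p + q ∸ 1)
  second zero    = refl
  second (suc p) = cong (λ m → suc p * h (m + q ∸ 1)) (sym (+-suc c p))
  third : ∀ q → q * h (c + p + (q ∸ 1)) ≡ q * h (c + p + q ∸ 1)
  third zero    = refl
  third (suc q) = cong (λ m → suc q * h (m ∸ 1)) (sym (+-suc (c + p) q))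
  collect : ∀ c p q m → c * m + p * m + q * m ≡ (c + p + q) * m
  collect = solve-∀

level : ℕ → Weight
level s c p q = 𝟙 (does (c + p + q ≟ℕ s))

-- An edge lies on level `s` of a card either because it dropped from level `suc s`, in `suc s`
-- ways, or because it was on level `s` and the deleted vertex was outside.
lift-level : ∀ n s c p q → lift n (level s) c p q ≡ suc s * level (suc s) c p q + (n ∸ (2 + s)) * level s c p q
lift-level n s c p q = cong₂ _+_ (trans (shift-+ (λ m → 𝟙 (does (m ≟ℕ s))) c p q) (step (c + p + q))) (here (c + p + q))
  where
  here : ∀ m → (n ∸ (2 + m)) * 𝟙 (does (m ≟ℕ s)) ≡ (n ∸ (2 + s)) * 𝟙 (does (m ≟ℕ s))
  here m = *𝟙-cong (m ≟ℕ s) (cong (λ k → n ∸ (2 + k)))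
  step : ∀ m → m * 𝟙 (does (m ∸ 1 ≟ℕ s)) ≡ suc s * 𝟙 (does (m ≟ℕ suc s))
  step zero    = sym (*-zeroʳ s)
  step (suc m) = *𝟙-cong (m ≟ℕ s) (cong suc)

edgeSum-lift-level : ∀ G s → edgeSum G (lift (order G) (level s)) ≡
  suc s * edgeSum G (level (suc s)) + (order G ∸ (2 + s)) * edgeSum G (level s)
edgeSum-lift-level G s = begin
  edgeSum G (lift (order G) (level s))
    ≡⟨ edgeSum-cong-≗ G (lift (order G) (level s)) _ (lift-level (order G) s) ⟩
  edgeSum G (λ c p q → suc s * level (suc s) c p q + r * level s c p q)
    ≡⟨ edgeSum-+ G (λ c p q → suc s * level (suc s) c p q) (λ c p q → r * level s c p q) ⟩
  edgeSum G (λ c p q → suc s * level (suc s) c p q) + edgeSum G (λ c p q → r * level s c p q)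
    ≡⟨ cong₂ _+_ (edgeSum-* G (suc s) (level (suc s))) (edgeSum-* G r (level s)) ⟩
  suc s * edgeSum G (level (suc s)) + r * edgeSum G (level s) ∎
  where
  open ≡-Reasoning
  r = order G ∸ (2 + s)

SupportedAt : ℕ → Weight → Set
SupportedAt s φ = ∀ c p q → c + p + q ≢ s → φ c p q ≡ 0

shift-supported : ∀ {s φ} → SupportedAt s φ → SupportedAt (suc s) (shift φ)
shift-supported {s} {φ} supp c p q c+p+q≢1+s = cong₂ _+_ (cong₂ _+_ (first c c+p+q≢1+s) (second p c+p+q≢1+s)) (third q c+p+q≢1+s)
  where
  first : ∀ c → c + p + q ≢ suc s → c * φ (c ∸ 1) p q ≡ 0
  first zero    _ = refl
  first (suc c) h = trans (cong (suc c *_) (supp c p q (h ∘ cong suc))) (*-zeroʳ c)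
  second : ∀ p → c + p + q ≢ suc s → p * φ c (p ∸ 1) q ≡ 0
  second zero    _ = refl
  second (suc p) h = trans (cong (suc p *_) (supp c p q (h ∘ trans (cong (_+ q) (+-suc c p)) ∘ cong suc))) (*-zeroʳ p)
  third : ∀ q → c + p + q ≢ suc s → q * φ c p (q ∸ 1) ≡ 0
  third zero    _ = refl
  third (suc q) h = trans (cong (suc q *_) (supp c p q (h ∘ trans (+-suc (c + p) q) ∘ cong suc))) (*-zeroʳ q)

-- On the support of `φ` the coefficient of the outside vertices is constant, so it can be taken out
-- of the sum.
edgeSum-lift-supported : ∀ G n {s φ} → SupportedAt s φ →
  edgeSum G (lift n φ) ≡ edgeSum G (shift φ) + (n ∸ (2 + s)) * edgeSum G φ
edgeSum-lift-supported G n {s} {φ} supp = begin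
  edgeSum G (lift n φ)
    ≡⟨ edgeSum-cong-≗ G (lift n φ) _ (λ c p q → cong (shift φ c p q +_) (coefficient c p q)) ⟩
  edgeSum G (λ c p q → shift φ c p q + (n ∸ (2 + s)) * φ c p q)
    ≡⟨ edgeSum-+ G (shift φ) (λ c p q → (n ∸ (2 + s)) * φ c p q) ⟩
  edgeSum G (shift φ) + edgeSum G (λ c p q → (n ∸ (2 + s)) * φ c p q)
    ≡⟨ cong (edgeSum G (shift φ) +_) (edgeSum-* G (n ∸ (2 + s)) φ) ⟩
  edgeSum G (shift φ) + (n ∸ (2 + s)) * edgeSum G φ ∎
  where
  open ≡-Reasoning
  coefficient : ∀ c p q → (n ∸ (2 + (c + p + q))) * φ c p q ≡ (n ∸ (2 + s)) * φ c p q
  coefficient c p q with c + p + q ≟ℕ s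
  ... | yes refl = refl
  ... | no  ≢s rewrite supp c p q ≢s = trans (*-zeroʳ (n ∸ (2 + (c + p + q)))) (sym (*-zeroʳ (n ∸ (2 + s))))

module _ (G H : Graph) (H≈G : deck H ≈ᴰ deck G) where

  -- Going up divides by `suc s`, which is never 0. It yields only the sizes of whole levels: for a
  -- general weight, `shift` would not isolate a single triple on the next level.
  levels-from-bottom : edgeSum H (level 0) ≡ edgeSum G (level 0) →
    ∀ s → edgeSum H (level s) ≡ edgeSum G (level s)
  levels-from-bottom base zero    = base
  levels-from-bottom base (suc s) = *-cancelˡ-≡ _ _ (suc s) (+-cancelʳ-≡ (r * edgeSum G (level s)) _ _ (begin
    suc s * edgeSum H (level (suc s)) + r * edgeSum G (level s)
      ≡⟨ cong₂ (λ n e → suc s * edgeSum H (level (suc s)) + (n ∸ (2 + s)) * e)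
           (order-reconstructible G H H≈G) (levels-from-bottom base s) ⟨
    suc s * edgeSum H (level (suc s)) + (order H ∸ (2 + s)) * edgeSum H (level s)
      ≡⟨ edgeSum-lift-level H s ⟨
    edgeSum H (lift (order H) (level s))
      ≡⟨ cong (λ n → edgeSum H (lift n (level s))) (order-reconstructible G H H≈G) ⟩
    edgeSum H (lift (order G) (level s))
      ≡⟨ edgeSum-lift-reconstructible G H H≈G (level s) ⟩
    edgeSum G (lift (order G) (level s))
      ≡⟨ edgeSum-lift-level G s ⟩
    suc s * edgeSum G (level (suc s)) + r * edgeSum G (level s) ∎))
    where
    open ≡-Reasoning
    r = order G ∸ (2 + s)

  -- Downward induction, with `d` the distance from the top level. It works for arbitrary weights
  -- because `shift φ` is again supported on one level, the next one up; the coefficient to cancel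
  -- is the distance, positive below the top.
  edgeSum-from-top : ∀ {m} → 2 + m ≡ order G →
    (∀ x y → Adj G x y → span G x y ≢ m) → (∀ x y → Adj H x y → span H x y ≢ m) →
    ∀ d {s φ} → d + s ≡ m → SupportedAt s φ → edgeSum H φ ≡ edgeSum G φ
  edgeSum-from-top 2+m≡n topG topH zero {φ = φ} refl supp = trans
    (edgeSum-zero H φ (λ x y xy → supp (commonNbrs H x y) (privateNbrs H x y) (privateNbrs H y x) (topH x y xy)))
    (sym (edgeSum-zero G φ (λ x y xy → supp (commonNbrs G x y) (privateNbrs G x y) (privateNbrs G y x) (topG x y xy))))
  edgeSum-from-top {m} 2+m≡n topG topH (suc d) {s} {φ} d+s≡m supp =
    *-cancelˡ-≡ _ _ (suc d) (+-cancelˡ-≡ (edgeSum G (shift φ)) _ _ (begin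
      edgeSum G (shift φ) + suc d * edgeSum H φ
        ≡⟨ cong₂ (λ e k → e + k * edgeSum H φ)
             (edgeSum-from-top 2+m≡n topG topH d (trans (+-suc d s) d+s≡m) (shift-supported supp)) r≡1+d ⟨
      edgeSum H (shift φ) + r * edgeSum H φ
        ≡⟨ edgeSum-lift-supported H (order G) supp ⟨
      edgeSum H (lift (order G) φ)
        ≡⟨ edgeSum-lift-reconstructible G H H≈G φ ⟩
      edgeSum G (lift (order G) φ)
        ≡⟨ edgeSum-lift-supported G (order G) supp ⟩
      edgeSum G (shift φ) + r * edgeSum G φ
        ≡⟨ cong (λ k → edgeSum G (shift φ) + k * edgeSum G φ) r≡1+d ⟩
      edgeSum G (shift φ) + suc d * edgeSum G φ ∎))
    where
    open ≡-Reasoning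
    r = order G ∸ (2 + s)
    r≡1+d : r ≡ suc d
    r≡1+d = trans (cong (_∸ (2 + s)) (trans (sym 2+m≡n) (cong (2 +_) (sym d+s≡m)))) (m+n∸n≡m (suc d) s)

-- Domination

module _ (G : Graph) {x y : Vertex G} where

  covered : outsiders G x y ≡ 0 → ∀ z → (z ≡ x ⊎ z ≡ y) ⊎ (Adj G z x ⊎ Adj G z y)
  covered none z with sum≡0⇒≡0 (𝟙 ∘ isOutside G x y) none z
  ... | eq with z ≟ x | z ≟ y
  ... | yes z≡x | _       = inj₁ (inj₁ z≡x)
  ... | no _    | yes z≡y = inj₁ (inj₂ z≡y)
  ... | no _    | no _ with adj G z x | adj G z y
  ... | true  | _     = inj₂ (inj₁ _)
  ... | false | true  = inj₂ (inj₂ _)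

  -- Every vertex is an end of the edge or adjacent to one, so all walks can be routed through `x`.
  outsiders≡0⇒connected : Adj G x y → outsiders G x y ≡ 0 → Connected G
  outsiders≡0⇒connected xy none u v = to u ◅◅ from v
    where
    yx : Adj G y x
    yx = subst T (adj-sym G x y) xy
    to : ∀ z → Star (Adj G) z x
    to z with covered none z
    ... | inj₁ (inj₁ refl) = ε
    ... | inj₁ (inj₂ refl) = yx ◅ ε
    ... | inj₂ (inj₁ zx)   = zx ◅ ε
    ... | inj₂ (inj₂ zy)   = zy ◅ yx ◅ ε
    from : ∀ z → Star (Adj G) x z
    from z with covered none z
    ... | inj₁ (inj₁ refl) = ε
    ... | inj₁ (inj₂ refl) = xy ◅ ε
    ... | inj₂ (inj₁ zx)   = subst T (adj-sym G z x) zx ◅ ε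
    ... | inj₂ (inj₂ zy)   = xy ◅ subst T (adj-sym G z y) zy ◅ ε

  isolated : span G x y ≡ 0 → ∀ z → Adj G z x ⊎ Adj G z y → z ≡ x ⊎ z ≡ y
  isolated alone z nbr
    with sum≡0⇒≡0 (𝟙 ∘ isCommon G x y) (trans (sym (commonNbrs≡sum G x y)) (m+n≡0⇒m≡0 _ (m+n≡0⇒m≡0 _ alone))) z
       | sum≡0⇒≡0 (𝟙 ∘ isPrivate G x y) (trans (sym (privateNbrs≡sum G x y)) (m+n≡0⇒n≡0 (commonNbrs G x y) (m+n≡0⇒m≡0 _ alone))) z
       | sum≡0⇒≡0 (𝟙 ∘ isPrivate G y x) (trans (sym (privateNbrs≡sum G y x)) (m+n≡0⇒n≡0 (commonNbrs G x y + privateNbrs G x y) alone)) z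
  ... | ¬c | ¬p | ¬q with z ≟ x | z ≟ y | adj G z x | adj G z y
  ... | yes z≡x | _       | _     | _     = inj₁ z≡x
  ... | no _    | yes z≡y | _     | _     = inj₂ z≡y
  ... | no _    | no _    | true  | true  = contradiction ¬c λ ()
  ... | no _    | no _    | true  | false = contradiction ¬p λ ()
  ... | no _    | no _    | false | true  = contradiction ¬q λ ()
  ... | no _    | no _    | false | false with nbr
  ... | inj₁ ()
  ... | inj₂ ()

  -- A walk that starts at an end of an isolated edge never leaves its two ends; connectedness would
  -- then make the order 2.
  connected⇒span≢0 : Connected G → 3 ≤ order G → Adj G x y → span G x y ≢ 0
  connected⇒span≢0 conn 3≤n xy alone = <⇒≢ 3≤n (trans (sym (cong₂ (λ s o → 2 + (s + o)) alone none))
      (order≡2+span+outsiders G xy))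
    where
    stays : ∀ {u z} → Star (Adj G) u z → u ≡ x ⊎ u ≡ y → z ≡ x ⊎ z ≡ y
    stays ε         h = h
    stays (uv ◅ vz) h = stays vz (isolated alone _ (step h (subst T (adj-sym G _ _) uv)))
      where
      step : ∀ {u v} → u ≡ x ⊎ u ≡ y → Adj G v u → Adj G v x ⊎ Adj G v y
      step (inj₁ refl) vu = inj₁ vu
      step (inj₂ refl) vu = inj₂ vu
    none : outsiders G x y ≡ 0
    none = sum-zero λ z → inner z (stays (conn x z) (inj₁ refl))
      where
      inner : ∀ z → z ≡ x ⊎ z ≡ y → 𝟙 (isOutside G x y z) ≡ 0
      inner z (inj₁ z≡x) rewrite dec-true (z ≟ x) z≡x = refl
      inner z (inj₂ z≡y) rewrite dec-true (z ≟ y) z≡y = cong 𝟙 (∧-zeroʳ (not (does (z ≟ x))))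

Universal : (G : Graph) → Vertex G → Set
Universal G w = ∀ z → z ≡ w ⊎ Adj G w z

universal? : ∀ G → Dec (∃ (Universal G))
universal? G = any? λ w → all? λ z → z ≟ w ⊎-dec adj? G w z

∣p∪q∣≤∣p∣+∣q∣ : ∀ {n} (p q : Subset n) → ∣ p ∪ q ∣ ≤ ∣ p ∣ + ∣ q ∣
∣p∪q∣≤∣p∣+∣q∣ []            []            = z≤n
∣p∪q∣≤∣p∣+∣q∣ (outside ∷ p) (outside ∷ q) = ∣p∪q∣≤∣p∣+∣q∣ p q
∣p∪q∣≤∣p∣+∣q∣ (outside ∷ p) (inside  ∷ q) = ≤-trans (s≤s (∣p∪q∣≤∣p∣+∣q∣ p q)) (≤-reflexive (sym (+-suc ∣ p ∣ ∣ q ∣)))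
∣p∪q∣≤∣p∣+∣q∣ (inside  ∷ p) (outside ∷ q) = s≤s (∣p∪q∣≤∣p∣+∣q∣ p q)
∣p∪q∣≤∣p∣+∣q∣ (inside  ∷ p) (inside  ∷ q) = s≤s (≤-trans (∣p∪q∣≤∣p∣+∣q∣ p q) (+-monoʳ-≤ ∣ p ∣ (n≤1+n ∣ q ∣)))

x∈p⇒1≤∣p∣ : ∀ {n} {x : Fin n} {p} → x ∈ p → 1 ≤ ∣ p ∣
x∈p⇒1≤∣p∣ x∈p = ≤-trans (s≤s z≤n) (x∈p⇒∣p-x∣<∣p∣ x∈p)

module _ (G : Graph) (no-universal : ¬ ∃ (Universal G)) where

  -- The given vertex is dominated, so `S` is nonempty; if `S` had just one element, that element
  -- would be universal. In the graph of order 0 the empty set dominates, hence the vertex argument.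
  dominating⇒2≤ : Vertex G → ∀ S → Dominating G S → 2 ≤ ∣ S ∣
  dominating⇒2≤ v S dom with 2 ≤? ∣ S ∣
  ... | yes 2≤∣S∣ = 2≤∣S∣
  ... | no  2≰∣S∣ = contradiction (member (dom v)) (λ (u , u∈S) → no-universal (u , universal u u∈S))
    where
    member : v ∈ S ⊎ (∃[ u ] (u ∈ S × Adj G u v)) → ∃ (_∈ S)
    member (inj₁ v∈S)           = v , v∈S
    member (inj₂ (u , u∈S , _)) = u , u∈S
    unique : ∀ {u z} → u ∈ S → z ∈ S → z ≡ u
    unique {u} {z} u∈S z∈S with z ≟ u
    ... | yes z≡u = z≡u
    ... | no  z≢u = contradiction
      (≤-trans (s≤s (x∈p⇒1≤∣p∣ (x∈p∧x≢y⇒x∈p-y z∈S z≢u))) (x∈p⇒∣p-x∣<∣p∣ u∈S)) 2≰∣S∣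
    universal : ∀ u → u ∈ S → Universal G u
    universal u u∈S z with dom z
    ... | inj₁ z∈S            = inj₁ (unique u∈S z∈S)
    ... | inj₂ (t , t∈S , tz) = inj₂ (subst (λ t → Adj G t z) (unique u∈S t∈S) tz)

  no-dominating-edge : ¬ IsDominationNumber G 2 → ∀ x y → outsiders G x y ≢ 0
  no-dominating-edge γ≢2 x y none = γ≢2
    -- The same lower bound gives minimality and, with the union bound, the exact size of `S`; no
    -- case distinction on `x ≡ y` arises.
    ((S , dom , ≤-antisym ∣S∣≤2 (dominating⇒2≤ x S dom)) , dominating⇒2≤ x)
    where
    S = ⁅ x ⁆ ∪ ⁅ y ⁆
    x∈S : x ∈ S
    x∈S = x∈p∪q⁺ (inj₁ (x∈⁅x⁆ x))
    y∈S : y ∈ S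
    y∈S = x∈p∪q⁺ (inj₂ (x∈⁅x⁆ y))
    dom : Dominating G S
    dom z with covered G none z
    ... | inj₁ (inj₁ refl) = inj₁ x∈S
    ... | inj₁ (inj₂ refl) = inj₁ y∈S
    ... | inj₂ (inj₁ zx)   = inj₂ (x , x∈S , subst T (adj-sym G z x) zx)
    ... | inj₂ (inj₂ zy)   = inj₂ (y , y∈S , subst T (adj-sym G z y) zy)
    ∣S∣≤2 : ∣ S ∣ ≤ 2
    ∣S∣≤2 = ≤-trans (∣p∪q∣≤∣p∣+∣q∣ ⁅ x ⁆ ⁅ y ⁆) (≤-reflexive (cong₂ _+_ (∣⁅x⁆∣≡1 x) (∣⁅x⁆∣≡1 y)))

span-top⇒outsiders≡0 : ∀ G {m x y} → 2 + m ≡ order G → Adj G x y → span G x y ≡ m → outsiders G x y ≡ 0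
span-top⇒outsiders≡0 G {x = x} {y} 2+m≡n xy refl = +-cancelˡ-≡ (2 + span G x y) _ 0
  (trans (order≡2+span+outsiders G xy) (trans (sym 2+m≡n) (sym (+-identityʳ _))))

edgeSum≡0⇒ : ∀ G φ → edgeSum G φ ≡ 0 → ∀ x y → Adj G x y → weightAt G φ x y ≡ 0
edgeSum≡0⇒ G φ none x y xy with adj G x y | sum≡0⇒≡0 _ (sum≡0⇒≡0 (λ x → sum λ y → 𝟙 (adj G x y) * weightAt G φ x y) none x) y
... | true | eq = trans (sym (*-identityˡ _)) eq

level-zero : ∀ G s → (∀ x y → Adj G x y → span G x y ≢ s) → edgeSum G (level s) ≡ 0
level-zero G s h = edgeSum-zero G (level s) λ x y xy → cong 𝟙 (dec-false (span G x y ≟ℕ s) (h x y xy))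

module _ (G H : Graph) (H≈G : deck H ≈ᴰ deck G) (connected : Connected G) (3≤n : 3 ≤ order G)
  (no-universal : ¬ ∃ (Universal G)) (γ≢2 : ¬ IsDominationNumber G 2) where

  top-level-G : ∀ {m} → 2 + m ≡ order G → ∀ x y → Adj G x y → span G x y ≢ m
  top-level-G 2+m≡n x y xy span≡m =
    no-dominating-edge G no-universal γ≢2 x y (span-top⇒outsiders≡0 G 2+m≡n xy span≡m)

  -- A dominating edge would make H connected, so neither graph has an isolated edge; hence the
  -- graphs agree on the bottom level, and therefore on the top one, which is empty in G.
  top-level-H : ∀ {m} → 2 + m ≡ order G → ∀ x y → Adj H x y → span H x y ≢ m
  top-level-H {m} 2+m≡n x y xy span≡m = contradiction
    (edgeSum≡0⇒ H (level m) (trans (levels-from-bottom G H H≈G bottom m) (level-zero G m (top-level-G 2+m≡n))) x y xy)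
    (λ eq → 1+n≢0 (trans (sym (cong 𝟙 (dec-true (span H x y ≟ℕ m) span≡m))) eq))
    where
    n≡n = order-reconstructible G H H≈G
    H-connected : Connected H
    H-connected = outsiders≡0⇒connected H xy (span-top⇒outsiders≡0 H (trans 2+m≡n (sym n≡n)) xy span≡m)
    bottom : edgeSum H (level 0) ≡ edgeSum G (level 0)
    bottom = trans
      (level-zero H 0 λ _ _ → connected⇒span≢0 H H-connected (subst (3 ≤_) (sym n≡n) 3≤n))
      (sym (level-zero G 0 λ _ _ → connected⇒span≢0 G connected 3≤n))

  edgeSum-no-universal : ∀ {s φ} → s ≤ order G ∸ 3 → SupportedAt s φ → edgeSum H φ ≡ edgeSum G φ
  edgeSum-no-universal {s} s≤n∸3 = edgeSum-from-top G H H≈G 2+m≡n (top-level-G 2+m≡n) (top-level-H 2+m≡n)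
    (m ∸ s) (m∸n+n≡m (≤-trans s≤n∸3 (∸-monoʳ-≤ (order G) (n≤1+n 2))))
    where
    m = order G ∸ 2
    2+m≡n : 2 + m ≡ order G
    2+m≡n = m+[n∸m]≡n (<⇒≤ 3≤n)

-- Graphs with a universal vertex

-- `edgeSum G one` is the degree sum, twice the number of edges.
one : Weight
one _ _ _ = 1

-- An edge survives the deletion of every vertex except its two ends.
edgeSum-lift-one : ∀ G → edgeSum G (lift (order G) one) ≡ (order G ∸ 2) * edgeSum G one
edgeSum-lift-one G = trans
  (edgeSum-cong G (lift (order G) one) (λ _ _ _ → (order G ∸ 2) * 1) λ x y xy → begin
    weightAt G (lift (order G) one) x y
      ≡⟨ cong₂ _+_ (shift-+ (λ _ → 1) (commonNbrs G x y) (privateNbrs G x y) (privateNbrs G y x))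
           (cong (_* 1) (sym (outsiders≡ G xy))) ⟩
    span G x y * 1 + outsiders G x y * 1
      ≡⟨ *-distribʳ-+ 1 (span G x y) (outsiders G x y) ⟨
    (span G x y + outsiders G x y) * 1
      ≡⟨ cong (λ n → (n ∸ 2) * 1) (order≡2+span+outsiders G xy) ⟩
    (order G ∸ 2) * 1 ∎)
  (edgeSum-* G (order G ∸ 2) one)
  where open ≡-Reasoning

module _ (G H : Graph) (H≈G : deck H ≈ᴰ deck G) (3≤n : 3 ≤ order G) where

  edgeSum-one-reconstructible : edgeSum H one ≡ edgeSum G one
  edgeSum-one-reconstructible = *-cancelˡ-≡ _ _ (order G ∸ 2) {{>-nonZero (m<n⇒0<n∸m 3≤n)}} (begin
    (order G ∸ 2) * edgeSum H one ≡⟨ cong (λ n → (n ∸ 2) * edgeSum H one) (order-reconstructible G H H≈G) ⟨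
    (order H ∸ 2) * edgeSum H one ≡⟨ edgeSum-lift-one H ⟨
    edgeSum H (lift (order H) one) ≡⟨ cong (λ n → edgeSum H (lift n one)) (order-reconstructible G H H≈G) ⟩
    edgeSum H (lift (order G) one) ≡⟨ edgeSum-lift-reconstructible G H H≈G one ⟩
    edgeSum G (lift (order G) one) ≡⟨ edgeSum-lift-one G ⟩
    (order G ∸ 2) * edgeSum G one ∎)
    where open ≡-Reasoning

sum-𝟙≡n⇒ : ∀ {n} (t : Fin n → Bool) → sum (𝟙 ∘ t) ≡ n → ∀ i → t i ≡ true
sum-𝟙≡n⇒ {n} t sum≡n i = case (t i) (sum≡0⇒≡0 (𝟙 ∘ not ∘ t) none i)
  where
  complement : ∀ b → 𝟙 b + 𝟙 (not b) ≡ 1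
  complement true  = refl
  complement false = refl
  none : sum (𝟙 ∘ not ∘ t) ≡ 0
  none = +-cancelˡ-≡ n _ 0 (begin
    n + sum (𝟙 ∘ not ∘ t)             ≡⟨ cong (_+ sum (𝟙 ∘ not ∘ t)) sum≡n ⟨
    sum (𝟙 ∘ t) + sum (𝟙 ∘ not ∘ t)   ≡⟨ ∑-distrib-+ (𝟙 ∘ t) (𝟙 ∘ not ∘ t) ⟨
    sum (λ i → 𝟙 (t i) + 𝟙 (not (t i))) ≡⟨ trans (sum-cong-≗ (complement ∘ t)) (sum-one n) ⟩
    n                                 ≡⟨ +-identityʳ n ⟨
    n + 0                             ∎)
    where open ≡-Reasoning
  case : ∀ b → 𝟙 (not b) ≡ 0 → b ≡ true
  case true _ = refl

module _ {n : ℕ} (a : Fin (suc n) → Fin (suc n) → Bool)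
  (a-sym : ∀ x y → a x y ≡ a y x) (a-irrefl : ∀ x → a x x ≡ false) where

  private
    G = mkGraph (suc n) a a-sym a-irrefl

  -- Here `d` is the degree of `v`; it occurs twice because each edge at `v` is summed in both
  -- directions.
  edgeSum-one-remove : ∀ v → let d = sum (λ y → 𝟙 (a v (punchIn v y))) in
    edgeSum G one ≡ d + d + edgeSum (G - v) one
  edgeSum-one-remove v = begin
    sum (λ x → sum (e x))
      ≡⟨ sum-remove {i = v} (λ x → sum (e x)) ⟩
    sum (e v) + sum (λ x → sum (e (punchIn v x)))
      ≡⟨ cong₂ _+_ (sym (sum-punchIn v (e v) (loop v)))
           (sum-cong-≗ λ x → sum-remove {i = v} (e (punchIn v x))) ⟩
    sum (e v ∘ punchIn v) + sum (λ x → e (punchIn v x) v + sum (e (punchIn v x) ∘ punchIn v))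
      ≡⟨ cong₂ _+_ (sum-cong-≗ λ y → *-identityʳ (𝟙 (a v (punchIn v y))))
           (∑-distrib-+ (λ x → e (punchIn v x) v) (λ x → sum (e (punchIn v x) ∘ punchIn v))) ⟩
    d + (sum (λ x → e (punchIn v x) v) + edgeSum (G - v) one)
      ≡⟨ cong (λ k → d + (k + edgeSum (G - v) one))
           (sum-cong-≗ λ x → trans (*-identityʳ (𝟙 (a (punchIn v x) v))) (cong 𝟙 (a-sym (punchIn v x) v))) ⟩
    d + (d + edgeSum (G - v) one)
      ≡⟨ +-assoc d d _ ⟨
    d + d + edgeSum (G - v) one ∎
    where
    open ≡-Reasoning
    e : Fin (suc n) → Fin (suc n) → ℕ
    e x y = 𝟙 (a x y) * 1
    d = sum (λ y → 𝟙 (a v (punchIn v y)))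
    loop : ∀ v → e v v ≡ 0
    loop v rewrite a-irrefl v = refl

punchIn-view : ∀ {n} (w x : Fin (suc n)) → x ≡ w ⊎ ∃[ x′ ] (x ≡ punchIn w x′)
punchIn-view w x with w ≟ x
... | yes w≡x = inj₁ (sym w≡x)
... | no  w≢x = inj₂ (punchOut w≢x , sym (punchIn-punchOut w≢x))

insert-at : ∀ {m n} i j (π : Permutation m n) → insert i j π ⟨$⟩ʳ i ≡ j
insert-at i j π with i ≟ i
... | yes _   = refl
... | no  i≢i = contradiction refl i≢i

module _ {n : ℕ} (a b : Fin (suc n) → Fin (suc n) → Bool)
  (a-sym : ∀ x y → a x y ≡ a y x) (a-irrefl : ∀ x → a x x ≡ false)
  (b-sym : ∀ x y → b x y ≡ b y x) (b-irrefl : ∀ x → b x x ≡ false) where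

  private
    G = mkGraph (suc n) a a-sym a-irrefl
    H = mkGraph (suc n) b b-sym b-irrefl

  -- The isomorphism of the cards is extended by sending `w` to `v`; pairs containing `w` are
  -- preserved because both vertices are adjacent to everything else.
  cone-≅ : ∀ w v → (∀ x → a w (punchIn w x) ≡ true) → (∀ x → b v (punchIn v x) ≡ true) →
    (G - w) ≅ (H - v) → G ≅ H
  cone-≅ w v a-full b-full (mk≅ π pres) = mk≅ (insert w v π) preserves
    where
    f : Fin (suc n) → Fin (suc n)
    f = insert w v π ⟨$⟩ʳ_
    preserves : ∀ x y → a x y ≡ b (f x) (f y)
    preserves x y with punchIn-view w x | punchIn-view w y
    ... | inj₁ refl        | inj₁ refl rewrite insert-at w v π = trans (a-irrefl w) (sym (b-irrefl v))
    ... | inj₁ refl        | inj₂ (y′ , refl) rewrite insert-at w v π | insert-punchIn w v π y′ =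
      trans (a-full y′) (sym (b-full _))
    ... | inj₂ (x′ , refl) | inj₁ refl rewrite insert-at w v π | insert-punchIn w v π x′ =
      trans (trans (a-sym _ w) (a-full x′)) (sym (trans (b-sym _ v) (b-full _)))
    ... | inj₂ (x′ , refl) | inj₂ (y′ , refl) rewrite insert-punchIn w v π x′ | insert-punchIn w v π y′ = pres x′ y′

  universal-≅ : deck H ≈ᴰ deck G → 3 ≤ suc n → ∃ (Universal G) → G ≅ H
  universal-≅ H≈G 3≤n (w , w-universal) with matching-card G H H≈G w
  ... | v , G-w≅H-v = cone-≅ w v a-full (sum-𝟙≡n⇒ (λ y → b v (punchIn v y)) (trans dv≡dw dw≡n)) G-w≅H-v
    where
    a-full : ∀ x → a w (punchIn w x) ≡ true
    a-full x with w-universal (punchIn w x)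
    ... | inj₁ eq = contradiction eq (punchInᵢ≢i w x)
    ... | inj₂ wx = Equivalence.to T-≡ wx
    dw dv : ℕ
    dw = sum (λ y → 𝟙 (a w (punchIn w y)))
    dv = sum (λ y → 𝟙 (b v (punchIn v y)))
    dw≡n : dw ≡ n
    dw≡n = trans (sum-cong-≗ (cong 𝟙 ∘ a-full)) (sum-one n)
    dv≡dw : dv ≡ dw
    -- The degree of a deleted vertex is the number of edges of the graph minus that of the card,
    -- and both numbers agree here.
    dv≡dw = m+m-injective (+-cancelʳ-≡ (edgeSum (H - v) one) _ _ (begin
      dv + dv + edgeSum (H - v) one ≡⟨ edgeSum-one-remove b b-sym b-irrefl v ⟨
      edgeSum H one                 ≡⟨ edgeSum-one-reconstructible G H H≈G 3≤n ⟩
      edgeSum G one                 ≡⟨ edgeSum-one-remove a a-sym a-irrefl w ⟩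
      dw + dw + edgeSum (G - w) one ≡⟨ cong (dw + dw +_) (edgeSum-≅ G-w≅H-v one) ⟩
      dw + dw + edgeSum (H - v) one ∎))
      where open ≡-Reasoning

edgeSum-universal : ∀ G H → deck H ≈ᴰ deck G → 3 ≤ order G → ∃ (Universal G) →
  ∀ φ → edgeSum H φ ≡ edgeSum G φ
edgeSum-universal G@(mkGraph (suc n) a a-sym a-irrefl) H@(mkGraph _ b b-sym b-irrefl) H≈G 3≤n univ φ
  -- Identifying the orders puts both graphs on the same vertex type.
  with refl ← order-reconstructible G H H≈G
  = sym (edgeSum-≅ (universal-≅ a b a-sym a-irrefl b-sym b-irrefl H≈G 3≤n univ) φ)

edgeSum-reconstructible : ∀ G H → deck H ≈ᴰ deck G → Connected G → 3 ≤ order G → ¬ IsDominationNumber G 2 →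
  ∀ {s φ} → s ≤ order G ∸ 3 → SupportedAt s φ → edgeSum H φ ≡ edgeSum G φ
edgeSum-reconstructible G H H≈G connected 3≤n γ≢2 {φ = φ} s≤n∸3 supp with universal? G
... | yes univ  = edgeSum-universal G H H≈G 3≤n univ φ
... | no  ¬univ = edgeSum-no-universal G H H≈G connected 3≤n ¬univ γ≢2 s≤n∸3 supp

-- From edge sums to dav

length-filter-cartesianProduct : ∀ {m n} {A B : Set} {P : A × B → Set} (P? : U.Decidable P)
  (f : Fin m → A) (g : Fin n → B) →
  length (filter P? (cartesianProduct (tabulate f) (tabulate g))) ≡ sum λ i → sum λ j → 𝟙 (does (P? (f i , g j)))
length-filter-cartesianProduct {zero}  P? f g = refl
length-filter-cartesianProduct {suc m} P? f g = begin
  length (filter P? (map (f zero ,_) (tabulate g) ++ rest))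
    ≡⟨ cong length (filter-++ P? (map (f zero ,_) (tabulate g)) rest) ⟩
  length (filter P? (map (f zero ,_) (tabulate g)) ++ filter P? rest)
    ≡⟨ length-++ (filter P? (map (f zero ,_) (tabulate g))) ⟩
  length (filter P? (map (f zero ,_) (tabulate g))) + length (filter P? rest)
    ≡⟨ cong₂ _+_ (trans (cong (length ∘ filter P?) (map-tabulate g (f zero ,_))) (length-filter-tabulate P? ((f zero ,_) ∘ g)))
         (length-filter-cartesianProduct P? (f ∘ suc) g) ⟩
  sum (λ j → 𝟙 (does (P? (f zero , g j)))) + sum (λ i → sum λ j → 𝟙 (does (P? (f (suc i) , g j)))) ∎
  where
  open ≡-Reasoning
  rest = cartesianProduct (tabulate (f ∘ suc)) (tabulate g)

-- In the second copy of the sum the two indices are exchanged, so that it covers the pairs above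
-- the diagonal's other side; the diagonal itself contributes 0.
sum-<? : ∀ {n} (t : Fin n → Fin n → Bool) → (∀ x y → t x y ≡ t y x) → (∀ x → t x x ≡ false) →
  let s = sum (λ x → sum λ y → 𝟙 (does (x <? y) ∧ t x y)) in s + s ≡ sum (λ x → sum λ y → 𝟙 (t x y))
sum-<? t t-sym t-irrefl = begin
  sum (λ x → sum (below x)) + sum (λ x → sum (below x))
    ≡⟨ cong (sum (λ x → sum (below x)) +_) (∑-comm below) ⟩
  sum (λ x → sum (below x)) + sum (λ x → sum λ y → below y x)
    ≡⟨ ∑-distrib-+ (λ x → sum (below x)) (λ x → sum λ y → below y x) ⟨
  sum (λ x → sum (below x) + sum λ y → below y x)
    ≡⟨ sum-cong-≗ (λ x → sym (∑-distrib-+ (below x) (λ y → below y x))) ⟩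
  sum (λ x → sum λ y → below x y + below y x)
    ≡⟨ sum-cong-≗ (λ x → sum-cong-≗ λ y → split x y) ⟩
  sum (λ x → sum λ y → 𝟙 (t x y)) ∎
  where
  open ≡-Reasoning
  below : _ → _ → ℕ
  below x y = 𝟙 (does (x <? y) ∧ t x y)
  split : ∀ x y → below x y + below y x ≡ 𝟙 (t x y)
  split x y with <-cmp x y
  ... | tri< x<y _ y≮x rewrite dec-true (x <? y) x<y | dec-false (y <? x) y≮x = +-identityʳ _
  ... | tri≈ x≮x refl _ rewrite t-irrefl x | ∧-zeroʳ (does (x <? x)) = refl
  ... | tri> x≮y _ y<x rewrite dec-false (x <? y) x≮y | dec-true (y <? x) y<x = cong 𝟙 (t-sym y x)

hit : (k₁ k₂ k₃ c p q : ℕ) → Bool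
hit k₁ k₂ k₃ c p q = does (c ≟ℕ k₁) ∧ does (p ≟ℕ k₂) ∧ does (q ≟ℕ k₃)

-- Symmetric in `p` and `q`, as pairs are unordered. A disjunction instead of a sum keeps the value
-- at 1 when both namings of the ends match, as for `k₂ ≡ k₃`.
davWeight : (k₁ k₂ k₃ : ℕ) → Weight
davWeight k₁ k₂ k₃ c p q = 𝟙 (hit k₁ k₂ k₃ c p q ∨ hit k₁ k₂ k₃ c q p)

davWeight-supported : ∀ k₁ k₂ k₃ → SupportedAt (k₁ + k₂ + k₃) (davWeight k₁ k₂ k₃)
davWeight-supported k₁ k₂ k₃ c p q ≢k =
  cong₂ (λ b b′ → 𝟙 (b ∨ b′)) (miss p q ≢k) (miss q p (≢k ∘ trans (swap c p q)))
  where
  swap : ∀ c p q → c + p + q ≡ c + q + p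
  swap = solve-∀
  miss : ∀ p q → c + p + q ≢ k₁ + k₂ + k₃ → hit k₁ k₂ k₃ c p q ≡ false
  miss p q ≢k = dec-false (c ≟ℕ k₁ ×-dec p ≟ℕ k₂ ×-dec q ≟ℕ k₃) λ { (refl , refl , refl) → ≢k refl }

dav+dav≡edgeSum : ∀ G k₁ k₂ k₃ → dav G k₁ k₂ k₃ + dav G k₁ k₂ k₃ ≡ edgeSum G (davWeight k₁ k₂ k₃)
dav+dav≡edgeSum G k₁ k₂ k₃ = begin
  dav G k₁ k₂ k₃ + dav G k₁ k₂ k₃
    ≡⟨ cong (λ d → d + d) (length-filter-cartesianProduct
         (λ (x , y) → x <? y ×-dec (davPair? G k₁ k₂ k₃ x y ⊎-dec davPair? G k₁ k₂ k₃ y x)) (λ x → x) (λ y → y)) ⟩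
  s + s
    ≡⟨ sum-<? t (λ x y → ∨-comm (pair x y) (pair y x)) t-irrefl ⟩
  sum (λ x → sum λ y → 𝟙 (t x y))
    ≡⟨ sum-cong-≗ (λ x → sum-cong-≗ λ y → pointwise x y) ⟩
  edgeSum G (davWeight k₁ k₂ k₃) ∎
  where
  open ≡-Reasoning
  pair t : Vertex G → Vertex G → Bool
  pair x y = adj G x y ∧ hit k₁ k₂ k₃ (commonNbrs G x y) (privateNbrs G x y) (privateNbrs G y x)
  t x y = pair x y ∨ pair y x
  s = sum (λ x → sum λ y → 𝟙 (does (x <? y) ∧ t x y))
  t-irrefl : ∀ x → t x x ≡ false
  t-irrefl x rewrite adj-irrefl G x = refl
  pointwise : ∀ x y → 𝟙 (t x y) ≡ 𝟙 (adj G x y) * weightAt G (davWeight k₁ k₂ k₃) x y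
  -- After the rewriting both namings of the pair share the adjacency bit and the number of common
  -- neighbours, which turns the second one into `hit` with `p` and `q` exchanged.
  pointwise x y rewrite adj-sym G y x | commonNbrs-sym G y x with adj G x y
  ... | true  = sym (*-identityˡ _)
  ... | false = refl

theorem18 : (G : Graph) → Connected G → 12 ≤ order G → ¬ IsDominationNumber G 2 →
    (∀ k₁ k₂ k₃ → k₁ + k₂ + k₃ ≤ order G ∸ 3 → ReconstructibleAt G (λ H → dav H k₁ k₂ k₃))
    × (∀ k₁ k → k₁ + 2 * k ≤ order G ∸ 3 → ReconstructibleAt G (λ H → dav H k₁ k k))
theorem18 G connected 12≤n γ≢2 = reconstruct ,
  -- The second family is the diagonal case of the first.
  λ k₁ k k₁+2k≤n∸3 → reconstruct k₁ k k (subst (_≤ order G ∸ 3) (regroup k₁ k) k₁+2k≤n∸3)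
  where
  regroup : ∀ m k → m + 2 * k ≡ m + k + k
  regroup = solve-∀
  reconstruct : ∀ k₁ k₂ k₃ → k₁ + k₂ + k₃ ≤ order G ∸ 3 → ReconstructibleAt G (λ H → dav H k₁ k₂ k₃)
  reconstruct k₁ k₂ k₃ k≤n∸3 H H≈G = m+m-injective (begin
    dav H k₁ k₂ k₃ + dav H k₁ k₂ k₃  ≡⟨ dav+dav≡edgeSum H k₁ k₂ k₃ ⟩
    edgeSum H (davWeight k₁ k₂ k₃)   ≡⟨ edgeSum-reconstructible G H H≈G connected (≤-trans (m≤m+n 3 9) 12≤n) γ≢2
                                          k≤n∸3 (davWeight-supported k₁ k₂ k₃) ⟩
    edgeSum G (davWeight k₁ k₂ k₃)   ≡⟨ dav+dav≡edgeSum G k₁ k₂ k₃ ⟨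
    dav G k₁ k₂ k₃ + dav G k₁ k₂ k₃  ∎)
    where open ≡-Reasoning
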